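{- Let $a,n,b,p,k$ be positive integers with $a>b$. If there exist a partition of $\{1,\dots,p\}$ into $k$ sum-free subsets and a $b$-WS-template $(A_1,\dots,A_{n+1})$ with width $a$ and $n+1$ colors, then there exists a partition of $\{1,\dots,pa+b\}$ into $k+n$ weakly sum-free subsets.
   Context: A set $A \subseteq \mathbb{N}$ is sum-free if for all $(a,b)\in A^2$ (allowing $a=b$), $a+b \notin A$; it is weakly sum-free if for all $(a,b)\in A^2$ with $a\neq b$, $a+b\notin A$. For positive integers $a>b$, let $\pi(x) = (x \bmod a) + a\cdot \mathbb{1}_{\{0,\dots,b\}}(x \bmod a)$. For positive integers $a,m,b$ with $a>b$, a partition $(A_1,\dots,A_m)$ of $\{1,\dots,a+b\}$ is a $b$-WS-template with width $a$ and $m$ colors if: (i) every $A_i$ is weakly sum-free; (ii) every $A_i\setminus\{1,\dots,b\}$ is sum-free; (iii) for all $(x,y)\in A_m^2$, $x+y>b+2a$ implies $x+y-2a\notin A_m$; (iv) for all $i\in\{1,\dots,m-1\}$ and $(x,y)\in A_i^2$, $x+y>a+b$ implies $\pi(x+y)\notin A_i$. -}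

module Defs where

open import Data.Bool.Base using (if_then_else_)
open import Data.Fin.Base using (Fin; toℕ)
open import Data.Nat using (ℕ; suc; _+_; _*_; _∸_; _≤_; _<_; _>_; NonZero; _%_; _≤ᵇ_)
open import Data.Product.Base using (_×_)
open import Level using (0ℓ)
open import Relation.Binary.PropositionalEquality.Core using (_≡_; _≢_)
open import Relation.Unary using (Pred; _∈_; _∉_; _≐_; _⊥_; _∖_; ⋃)

⟦1‥_⟧ : ℕ → Pred ℕ 0ℓ
⟦1‥ n ⟧ x = 1 ≤ x × x ≤ n

SumFree : Pred ℕ 0ℓ → Set
SumFree A = ∀ x y → x ∈ A → y ∈ A → x + y ∉ A

WeaklySumFree : Pred ℕ 0ℓ → Set
WeaklySumFree A = ∀ x y → x ∈ A → y ∈ A → x ≢ y → x + y ∉ A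

-- As is usual for Schur-type colourings, some of the classes may be empty.
record IsPartition (X : Pred ℕ 0ℓ) {m : ℕ} (A : Fin m → Pred ℕ 0ℓ) : Set where
  field
    union    : ⋃ (Fin m) A ≐ X
    disjoint : ∀ i j → i ≢ j → A i ⊥ A j

𝟙[0‥_] : ℕ → ℕ → ℕ
𝟙[0‥ b ] r = if r ≤ᵇ b then 1 else 0

π : (a b : ℕ) .{{_ : NonZero a}} → ℕ → ℕ
π a b x = x % a + a * 𝟙[0‥ b ] (x % a)

-- Colours are numbered from 0 here, so the class written A_j with
-- 1 ≤ j ≤ m is A i for suc (toℕ i) ≡ j.  The truncated subtraction in
-- `last` is only used where it agrees with integer subtraction.
record IsWSTemplate (b a : ℕ) .{{_ : NonZero a}}
                    {m : ℕ} (A : Fin m → Pred ℕ 0ℓ) : Set where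
  field
    partition     : IsPartition ⟦1‥ a + b ⟧ A
    weaklySumFree : ∀ i → WeaklySumFree (A i)
    sumFree       : ∀ i → SumFree (A i ∖ ⟦1‥ b ⟧)
    last          : ∀ i → suc (toℕ i) ≡ m → ∀ x y → x ∈ A i → y ∈ A i →
                    x + y > b + 2 * a → (x + y) ∸ 2 * a ∉ A i
    notLast       : ∀ i → suc (toℕ i) < m → ∀ x y → x ∈ A i → y ∈ A i →
                    x + y > a + b → π a b (x + y) ∉ A i

{-# OPTIONS --safe #-}

-- Every x is written uniquely as x = rep x + lev x * a, where rep x lies in
-- {b+1,…,a+b} if x > b, while rep x = x and lev x = 0 if x ≤ b.  Each of the first
-- n template colours is pulled back along rep; the last one is refined by putting
-- x into the class of suc (lev x) in the sum-free partition.  If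
-- s = rep x + rep y stays within a+b, then rep (x+y) = s and template (weak)
-- sum-freeness excludes x+y.  Otherwise, a non-last colour is excluded by (iv).
-- For the last one: if s ≤ 2a+b there is exactly one carry, so that
-- suc (lev (x+y)) = suc (lev x) + suc (lev y) and sum-freeness of the given
-- partition applies; if s > 2a+b then rep (x+y) = s - 2a and (iii) applies.
module Submission where

open import Defs
open import Data.Fin.Base using (Fin)
open import Data.Nat using (ℕ; _+_; _*_; _>_; NonZero)
open import Data.Product using (_×_; Σ-syntax)
open import Level using (0ℓ)
open import Relation.Unary using (Pred)

open import Data.Fin.Base using (zero; toℕ; splitAt; join; _↑ˡ_; _↑ʳ_)
open import Data.Fin.Properties
  using (toℕ<n; ↑ˡ-injective; toℕ-↑ˡ; toℕ-↑ʳ; splitAt-↑ˡ; splitAt-↑ʳ; splitAt-join; join-splitAt)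
open import Data.Nat using (zero; suc; _∸_; _≤_; _<_; z≤n; s≤s; _/_; _%_; _≤ᵇ_; _≤?_)
open import Data.Nat.DivMod
  using (m/n*n≤m; m*n/n≡m; m<n⇒m/n≡0; +-distrib-/-∣ʳ; m%n≡m∸m/n*n; m%n<n; m≡m%n+[m/n]*n; m<n*o⇒m/o<n)
open import Data.Nat.Divisibility using (n∣m*n)
open import Data.Nat.Properties
open import Data.Nat.Tactic.RingSolver using (solve-∀)
open import Data.Product using (_,_; proj₁; proj₂)
open import Data.Sum using (_⊎_; inj₁; inj₂; [_,_]′)
open import Function using (const; _∘_)
open import Relation.Binary.PropositionalEquality
  using (_≡_; _≢_; refl; sym; trans; cong; cong₂; subst; subst₂; module ≡-Reasoning)
open import Relation.Nullary using (yes; no; contradiction; ofʸ; ofⁿ)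
open import Relation.Unary using (_∈_; _∉_)

-- Division by `a` with representatives shifted above `b`.

module Decomposition (a b : ℕ) .{{_ : NonZero a}} (b<a : b < a) where

  -- The offset `suc b` makes the level rise at `a + b + 1`, and truncation gives level 0 to every
  -- `x ≤ b` without a case split.
  lev : ℕ → ℕ
  lev x = (x ∸ suc b) / a

  rep : ℕ → ℕ
  rep x = x ∸ lev x * a

  rep+lev*a≡x : ∀ x → rep x + lev x * a ≡ x
  rep+lev*a≡x x = m∸n+n≡m (≤-trans (m/n*n≤m (x ∸ suc b) a) (m∸n≤m x (suc b)))

  lev-base : ∀ {t} → t ≤ a + b → lev t ≡ 0
  lev-base {t} t≤a+b = m<n⇒m/n≡0 (m<n+o⇒m∸n<o t (suc b)
    (s≤s (≤-trans t≤a+b (≤-reflexive (+-comm a b)))))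

  rep-base : ∀ {t} → t ≤ a + b → rep t ≡ t
  rep-base {t} t≤a+b = cong (λ l → t ∸ l * a) (lev-base t≤a+b)

  -- Since `b < t`, the subtraction of `suc b` is exact, so the multiple of `a` passes through it
  -- into the division. For `t ≤ b` truncation can break this.
  lev-shift : ∀ {t} q → b < t → lev (t + q * a) ≡ lev t + q
  lev-shift {t} q b<t = begin
    (t + q * a ∸ suc b) / a       ≡⟨ cong (_/ a) (+-∸-comm (q * a) b<t) ⟩
    (t ∸ suc b + q * a) / a       ≡⟨ +-distrib-/-∣ʳ (t ∸ suc b) (n∣m*n q) ⟩
    lev t + q * a / a             ≡⟨ cong (lev t +_) (m*n/n≡m q a) ⟩
    lev t + q                     ∎
    where open ≡-Reasoning

  rep-shift : ∀ {t} q → b < t → rep (t + q * a) ≡ rep t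
  rep-shift {t} q b<t = begin
    t + q * a ∸ lev (t + q * a) * a  ≡⟨ cong (λ l → t + q * a ∸ l * a) (lev-shift q b<t) ⟩
    t + q * a ∸ (lev t + q) * a      ≡⟨ cong₂ _∸_ (+-comm t (q * a))
                                          (trans (cong (_* a) (+-comm (lev t) q)) (*-distribʳ-+ a q (lev t))) ⟩
    q * a + t ∸ (q * a + lev t * a)  ≡⟨ [m+n]∸[m+o]≡n∸o (q * a) t (lev t * a) ⟩
    rep t                            ∎
    where open ≡-Reasoning

  -- Confines `rep x` to an interval of length `a`: the remainder is at least 0 and less than `a`.
  rep-large : ∀ {x} → b < x → rep x ≡ suc b + (x ∸ suc b) % a
  rep-large {x} b<x = begin
    x ∸ l * a                          ≡⟨ cong (_∸ l * a) (m+[n∸m]≡n b<x) ⟨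
    suc b + (x ∸ suc b) ∸ l * a        ≡⟨ +-∸-assoc (suc b) (m/n*n≤m (x ∸ suc b) a) ⟩
    suc b + (x ∸ suc b ∸ l * a)        ≡⟨ cong (suc b +_) (m%n≡m∸m/n*n (x ∸ suc b) a) ⟨
    suc b + (x ∸ suc b) % a            ∎
    where
    open ≡-Reasoning
    l = lev x

  b<rep : ∀ {x} → b < x → b < rep x
  b<rep b<x = subst (b <_) (sym (rep-large b<x)) (m≤m+n (suc b) _)

  rep-small : ∀ {x} → x ≤ b → rep x ≡ x
  rep-small x≤b = rep-base (m≤n⇒m≤o+n a x≤b)

  rep≤b⇒x≤b : ∀ {x} → rep x ≤ b → x ≤ b
  rep≤b⇒x≤b rep≤b = ≮⇒≥ λ b<x → <⇒≱ (b<rep b<x) rep≤b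

  rep≤a+b : ∀ x → rep x ≤ a + b
  rep≤a+b x with x ≤? b
  ... | yes x≤b = ≤-trans (m∸n≤m x (lev x * a)) (m≤n⇒m≤o+n a x≤b)
  ... | no  x≰b = begin
    rep x                     ≡⟨ rep-large (≰⇒> x≰b) ⟩
    suc b + (x ∸ suc b) % a   ≡⟨ +-suc b _ ⟨
    b + suc ((x ∸ suc b) % a) ≤⟨ +-monoʳ-≤ b (m%n<n (x ∸ suc b) a) ⟩
    b + a                     ≡⟨ +-comm b a ⟩
    a + b                     ∎
    where open ≤-Reasoning

  1≤rep : ∀ {x} → 1 ≤ x → 1 ≤ rep x
  1≤rep {x} 1≤x with x ≤? b
  ... | yes x≤b = subst (1 ≤_) (sym (rep-small x≤b)) 1≤x
  ... | no  x≰b = ≤-trans (s≤s z≤n) (b<rep (≰⇒> x≰b))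

  lev<p : ∀ {p x} .{{_ : NonZero p}} → x ≤ p * a + b → lev x < p
  lev<p {p} {x} x≤pa+b = m<n*o⇒m/o<n (m<n+o⇒m∸n<o x (suc b) {p * a} {{m*n≢0 p a}}
    (s≤s (≤-trans x≤pa+b (≤-reflexive (+-comm (p * a) b)))))

  lev<p⇒x≤pa+b : ∀ {p} x → lev x < p → x ≤ p * a + b
  lev<p⇒x≤pa+b {suc p} x (s≤s lev≤p) = begin
    x                  ≡⟨ rep+lev*a≡x x ⟨
    rep x + lev x * a  ≤⟨ +-mono-≤ (rep≤a+b x) (*-monoˡ-≤ a lev≤p) ⟩
    (a + b) + p * a    ≡⟨ swapʳ a b (p * a) ⟩
    suc p * a + b      ∎
    where
    open ≤-Reasoning
    swapʳ : ∀ x y z → (x + y) + z ≡ (x + z) + y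
    swapʳ = solve-∀

  -- Both sides choose the number in `b+1, …, a+b` congruent to `t` modulo `a`: the remainder itself
  -- if it exceeds `b`, otherwise the remainder plus `a`.
  rep≡π : ∀ {t} → b < t → rep t ≡ π a b t
  rep≡π {t} b<t with t % a | m%n<n t a | t / a | m≡m%n+[m/n]*n t a
  ... | r | r<a | q | t≡r+qa with r ≤ᵇ b | ≤ᵇ-reflects-≤ r b
  rep≡π {t} b<t | r | r<a | zero  | t≡r+qa | _ | ofʸ r≤b =
    contradiction (subst (_≤ b) (sym (trans t≡r+qa (+-identityʳ r))) r≤b) (<⇒≱ b<t)
  -- One period is moved from the quotient to the remainder; `b < a` puts `r + a` above `b`.
  rep≡π {t} b<t | r | r<a | suc q | t≡r+qa | _ | ofʸ r≤b = begin
    rep t                  ≡⟨ cong rep (trans t≡r+qa (sym (+-assoc r a (q * a)))) ⟩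
    rep ((r + a) + q * a)  ≡⟨ rep-shift q (≤-trans b<a (m≤n+m a r)) ⟩
    rep (r + a)            ≡⟨ rep-base (≤-trans (≤-reflexive (+-comm r a)) (+-monoʳ-≤ a r≤b)) ⟩
    r + a                  ≡⟨ cong (r +_) (*-identityʳ a) ⟨
    r + a * 1              ∎
    where open ≡-Reasoning
  rep≡π {t} b<t | r | r<a | q | t≡r+qa | _ | ofⁿ r≰b = begin
    rep t                  ≡⟨ cong rep t≡r+qa ⟩
    rep (r + q * a)        ≡⟨ rep-shift q (≰⇒> r≰b) ⟩
    rep r                  ≡⟨ rep-base (≤-trans (<⇒≤ r<a) (m≤m+n a b)) ⟩
    r                      ≡⟨ trans (cong (r +_) (*-zeroʳ a)) (+-identityʳ r) ⟨
    r + a * 0              ∎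
    where open ≡-Reasoning

  +-decomposition : ∀ x y → x + y ≡ (rep x + rep y) + (lev x + lev y) * a
  +-decomposition x y = trans
    (cong₂ _+_ (sym (rep+lev*a≡x x)) (sym (rep+lev*a≡x y)))
    (regroup (rep x) (rep y) (lev x) (lev y) a)
    where
    regroup : ∀ r r′ l l′ c → (r + l * c) + (r′ + l′ * c) ≡ (r + r′) + (l + l′) * c
    regroup = solve-∀

  -- Shifting by multiples of `a` works when the sum of representatives exceeds `b`. Otherwise both
  -- representatives are at most `b`, so `rep` fixes `x` and `y`.
  rep-+ : ∀ x y → rep (x + y) ≡ rep (rep x + rep y)
  rep-+ x y with rep x + rep y ≤? b
  ... | yes s≤b = cong rep (sym (cong₂ _+_
    (rep-small (rep≤b⇒x≤b (m+n≤o⇒m≤o (rep x) s≤b)))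
    (rep-small (rep≤b⇒x≤b (m+n≤o⇒n≤o (rep x) s≤b)))))
  ... | no  s≰b = trans (cong rep (+-decomposition x y)) (rep-shift (lev x + lev y) (≰⇒> s≰b))

  lev-+ : ∀ x y → b < rep x + rep y → lev (x + y) ≡ lev (rep x + rep y) + (lev x + lev y)
  lev-+ x y b<s = trans (cong lev (+-decomposition x y)) (lev-shift (lev x + lev y) b<s)

  -- Removing one `a` from `s` lands in `b+1, …, a+b`, where the level is 0.
  lev-carry : ∀ {s} → a + b < s → s ≤ b + 2 * a → lev s ≡ 1
  lev-carry {s} a+b<s s≤b+2a = begin
    lev s                  ≡⟨ cong lev s≡ ⟩
    lev ((s ∸ a) + 1 * a)  ≡⟨ lev-shift 1 (subst (_< s ∸ a) (m+n∸m≡n a b) (∸-monoˡ-< a+b<s (m≤m+n a b))) ⟩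
    lev (s ∸ a) + 1        ≡⟨ cong (_+ 1) (lev-base (m≤n+o⇒m∸n≤o s a (≤-trans s≤b+2a (≤-reflexive (regroup a b))))) ⟩
    1                      ∎
    where
    open ≡-Reasoning
    s≡ : s ≡ (s ∸ a) + 1 * a
    s≡ = trans (sym (m∸n+n≡m (≤-trans (m≤m+n a b) (<⇒≤ a+b<s)))) (cong ((s ∸ a) +_) (sym (*-identityˡ a)))
    regroup : ∀ x y → y + 2 * x ≡ x + (x + y)
    regroup = solve-∀

  -- The upper bound is the largest sum of two representatives. As `b < a`, it is below `3a + b`, so
  -- a third carry cannot occur.
  rep-double-carry : ∀ {s} → b + 2 * a < s → s ≤ (a + b) + (a + b) → rep s ≡ s ∸ 2 * a
  rep-double-carry {s} b+2a<s s≤2a+2b = begin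
    rep s                          ≡⟨ cong rep (m∸n+n≡m (≤-trans (m≤n+m (2 * a) b) (<⇒≤ b+2a<s))) ⟨
    rep ((s ∸ 2 * a) + 2 * a)      ≡⟨ rep-shift 2 (subst (_< s ∸ 2 * a) (m+n∸n≡m b (2 * a)) (∸-monoˡ-< b+2a<s (m≤n+m (2 * a) b))) ⟩
    rep (s ∸ 2 * a)                ≡⟨ rep-base (m≤n+o⇒m∸n≤o s (2 * a) (≤-trans s≤2a+2b bound)) ⟩
    s ∸ 2 * a                      ∎
    where
    open ≡-Reasoning
    regroup : ∀ x y → (x + y) + (x + y) ≡ 2 * x + (y + y)
    regroup = solve-∀
    bound : (a + b) + (a + b) ≤ 2 * a + (a + b)
    bound = ≤-trans (≤-reflexive (regroup a b)) (+-monoʳ-≤ (2 * a) (+-monoˡ-≤ b (<⇒≤ b<a)))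

-- The extended colouring.

module Extension (a b n p k : ℕ) .{{_ : NonZero a}} .{{_ : NonZero p}} (b<a : b < a)
  (S : Fin k → Pred ℕ 0ℓ) (S-partition : IsPartition ⟦1‥ p ⟧ S) (S-sumFree : ∀ i → SumFree (S i))
  (A : Fin (n + 1) → Pred ℕ 0ℓ) (A-template : IsWSTemplate b a A)
  where

  open Decomposition a b b<a
  open IsWSTemplate A-template
  private
    module P = IsPartition partition
    module Q = IsPartition S-partition

  final : Fin (n + 1)
  final = n ↑ʳ zero

  templateColour : Fin k ⊎ Fin n → Fin (n + 1)
  templateColour = [ const final , _↑ˡ 1 ]′

  -- Levels are counted from 1 here, to match the set partitioned by `S`. An unrefined colour admits
  -- all of them up to `p`, which keeps its class within `p * a + b`.
  levels : Fin k ⊎ Fin n → Pred ℕ 0ℓ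
  levels = [ S , const ⟦1‥ p ⟧ ]′

  Class : Fin k ⊎ Fin n → Pred ℕ 0ℓ
  Class c x = rep x ∈ A (templateColour c) × suc (lev x) ∈ levels c

  ↑ˡ≢final : ∀ j → j ↑ˡ 1 ≢ final
  ↑ˡ≢final j eq with trans (sym (splitAt-↑ˡ n j 1)) (trans (cong (splitAt n) eq) (splitAt-↑ʳ n 1 zero))
  ... | ()

  ↑ˡ-notLast : (j : Fin n) → suc (toℕ (j ↑ˡ 1)) < n + 1
  ↑ˡ-notLast j = subst₂ _<_ (cong suc (sym (toℕ-↑ˡ j 1))) (+-comm 1 n) (s≤s (toℕ<n j))

  final-last : suc (toℕ final) ≡ n + 1
  final-last = trans (cong suc (toℕ-↑ʳ n (zero {0}))) (sym (+-suc n 0))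

  levels⊆ : ∀ c {l} → l ∈ levels c → l ∈ ⟦1‥ p ⟧
  levels⊆ (inj₁ i) l∈ = proj₁ Q.union (i , l∈)
  levels⊆ (inj₂ _) l∈ = l∈

  Class⇒range : ∀ c {x} → x ∈ Class c → x ∈ ⟦1‥ p * a + b ⟧
  Class⇒range c {x} (r∈ , l∈) =
    ≤-trans (proj₁ (proj₁ P.union (_ , r∈))) (m∸n≤m x (lev x * a)) ,
    lev<p⇒x≤pa+b x (proj₂ (levels⊆ c l∈))

  range⇒Class : ∀ {x} → x ∈ ⟦1‥ p * a + b ⟧ → Σ[ c ∈ Fin k ⊎ Fin n ] x ∈ Class c
  range⇒Class {x} (1≤x , x≤pa+b) with proj₂ P.union (1≤rep 1≤x , rep≤a+b x)
  ... | i , r∈ with splitAt n i | join-splitAt n 1 i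
  ... | inj₁ j    | refl = inj₂ j , r∈ , s≤s z≤n , lev<p x≤pa+b
  ... | inj₂ zero | refl with proj₂ Q.union (s≤s z≤n , lev<p x≤pa+b)
  ...   | i′ , l∈ = inj₁ i′ , r∈ , l∈

  -- Two refinements of the final colour are separated by their levels; in every other case the
  -- template colours differ.
  Class-disjoint : ∀ c d → c ≢ d → ∀ {x} → x ∈ Class c → x ∉ Class d
  Class-disjoint (inj₁ i) (inj₁ j) c≢d (_ , l∈) (_ , l∈′) = Q.disjoint i j (c≢d ∘ cong inj₁) (l∈ , l∈′)
  Class-disjoint (inj₁ i) (inj₂ j) c≢d (r∈ , _) (r∈′ , _) = P.disjoint _ _ (↑ˡ≢final j ∘ sym) (r∈ , r∈′)
  Class-disjoint (inj₂ i) (inj₁ j) c≢d (r∈ , _) (r∈′ , _) = P.disjoint _ _ (↑ˡ≢final i) (r∈ , r∈′)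
  Class-disjoint (inj₂ i) (inj₂ j) c≢d (r∈ , _) (r∈′ , _) =
    P.disjoint _ _ (c≢d ∘ cong inj₂ ∘ ↑ˡ-injective 1 i j) (r∈ , r∈′)

  -- Distinct `x` and `y` can share a representative, and then weak sum-freeness says nothing. But
  -- `rep` is the identity up to `b`, so a shared representative exceeds `b`, where the template
  -- colour is sum-free.
  rep+rep∉ : ∀ i {x y} → x ≢ y → rep x ∈ A i → rep y ∈ A i → rep x + rep y ∉ A i
  rep+rep∉ i {x} {y} x≢y x∈ y∈ s∈ with rep x ≟ rep y
  ... | no  rx≢ry = weaklySumFree i (rep x) (rep y) x∈ y∈ rx≢ry s∈
  ... | yes rx≡ry with rep x ≤? b
  ...   | yes rx≤b = x≢y (trans (sym (rep-small (rep≤b⇒x≤b rx≤b)))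
                           (trans rx≡ry (rep-small (rep≤b⇒x≤b (subst (_≤ b) rx≡ry rx≤b)))))
  ...   | no  rx≰b = sumFree i (rep x) (rep y)
                       (x∈ , rx≰b ∘ proj₂)
                       (y∈ , rx≰b ∘ subst (_≤ b) (sym rx≡ry) ∘ proj₂)
                       (s∈ , λ s∈b → rx≰b (m+n≤o⇒m≤o (rep x) (proj₂ s∈b)))

  Class-weaklySumFree : ∀ c → WeaklySumFree (Class c)
  Class-weaklySumFree c x y (x∈ , _) (y∈ , _) x≢y (s∈ , _) with rep x + rep y ≤? a + b
  -- Without a carry the levels are irrelevant, so both kinds of colour are treated at once.
  Class-weaklySumFree c x y (x∈ , _) (y∈ , _) x≢y (s∈ , _) | yes s≤a+b =
    rep+rep∉ _ x≢y x∈ y∈ (subst (A _) (trans (rep-+ x y) (rep-base s≤a+b)) s∈)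
  Class-weaklySumFree (inj₂ j) x y (x∈ , _) (y∈ , _) x≢y (s∈ , _) | no s≰a+b =
    notLast _ (↑ˡ-notLast j) (rep x) (rep y) x∈ y∈ a+b<s
      (subst (A _) (trans (rep-+ x y) (rep≡π (≤-trans (s≤s (m≤n+m b a)) a+b<s))) s∈)
    where a+b<s = ≰⇒> s≰a+b
  Class-weaklySumFree (inj₁ i) x y (x∈ , lx∈) (y∈ , ly∈) x≢y (s∈ , ls∈) | no s≰a+b
    with rep x + rep y ≤? b + 2 * a
  ... | yes s≤b+2a = S-sumFree i _ _ lx∈ ly∈ (subst (S i) level-sum ls∈)
    where
    open ≡-Reasoning
    a+b<s = ≰⇒> s≰a+b
    level-sum : suc (lev (x + y)) ≡ suc (lev x) + suc (lev y)
    level-sum = begin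
      suc (lev (x + y))
        ≡⟨ cong suc (lev-+ x y (≤-trans (s≤s (m≤n+m b a)) a+b<s)) ⟩
      suc (lev (rep x + rep y) + (lev x + lev y))
        ≡⟨ cong (λ l → suc (l + (lev x + lev y))) (lev-carry a+b<s s≤b+2a) ⟩
      suc (suc (lev x + lev y))
        ≡⟨ cong suc (+-suc (lev x) (lev y)) ⟨
      suc (lev x) + suc (lev y)  ∎
  ... | no s≰b+2a =
    last final final-last (rep x) (rep y) x∈ y∈ (≰⇒> s≰b+2a)
      (subst (A final)
        (trans (rep-+ x y) (rep-double-carry (≰⇒> s≰b+2a) (+-mono-≤ (rep≤a+b x) (rep≤a+b y)))) s∈)

  Colour : Fin (k + n) → Pred ℕ 0ℓ
  Colour = Class ∘ splitAt k

  Colour-partition : IsPartition ⟦1‥ p * a + b ⟧ Colour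
  Colour-partition = record
    { union    = (λ (i , x∈) → Class⇒range (splitAt k i) x∈)
               , λ x∈ → let c , x∈c = range⇒Class x∈ in
                   join k n c , subst (λ d → _ ∈ Class d) (sym (splitAt-join k n c)) x∈c
    ; disjoint = λ i j i≢j (x∈i , x∈j) → Class-disjoint (splitAt k i) (splitAt k j)
        (λ eq → i≢j (trans (sym (join-splitAt k n i)) (trans (cong (join k n) eq) (join-splitAt k n j))))
        x∈i x∈j
    }

theorem3p17 : (a n b p k : ℕ) → .{{_ : NonZero a}} → .{{_ : NonZero n}} → .{{_ : NonZero b}} →
    .{{_ : NonZero p}} → .{{_ : NonZero k}} → a > b →
    (Σ[ S ∈ (Fin k → Pred ℕ 0ℓ) ] IsPartition ⟦1‥ p ⟧ S × (∀ i → SumFree (S i))) →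
    (Σ[ A ∈ (Fin (n + 1) → Pred ℕ 0ℓ) ] IsWSTemplate b a A) →
    Σ[ B ∈ (Fin (k + n) → Pred ℕ 0ℓ) ] IsPartition ⟦1‥ p * a + b ⟧ B × (∀ i → WeaklySumFree (B i))
theorem3p17 a n b p k a>b (S , S-partition , S-sumFree) (A , A-template) =
  Colour , Colour-partition , λ i → Class-weaklySumFree (splitAt k i)
  where open Extension a b n p k a>b S S-partition S-sumFree A A-template
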